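{- Let $G(L)=(V,E,L)$ be a temporal graph or temporal digraph on $n$ vertices, let $S(L)$ be the set of all its time edges (resp. time arcs), and let $s\in V$ be a source vertex. Run the Foremost Journey Algorithm (described in the context) on input $(G(L),s)$. Then, for every vertex $v\in V$, $v\neq s$, the following hold: (a) If at termination $arrival\_time[v]<+\infty$, then there exists a foremost journey from $s$ to $v$, the arrival time of which is exactly $arrival\_time[v]$; this journey can be constructed by following the $parent$ pointers from $v$ in reverse order. (b) If at termination $arrival\_time[v]=+\infty$, then no $(s,v)$-journey exists in $G(L)$. (c) The time complexity of the algorithm is dominated by the time for sorting the set $S(L)$ of time edges (resp. time arcs) by their labels.
   Context: A temporal (di)graph is a triple $G(L)=(V,E,L)$ where $(V,E)$ is a finite (di)graph and $L=\{L_e\subseteq\mathbb{N}^*: e\in E\}$ assigns to each edge (arc) a (finite) set of positive integer labels. A time edge is a triple $(u,v,l)$ where $e=\{u,v\}$ (resp. $e=(u,v)$) is an edge (resp. arc) and $l\in L_e$; an undirected edge $\{u,v\}$ yields both $(u,v,l)$ and $(v,u,l)$ for every $l\in L_e$. A $(u,v)$-journey is a sequence of time edges $(u,u_1,l_1),(u_1,u_2,l_2),\ldots,(u_{k-1},v,l_k)$ with $l_i<l_{i+1}$ for all $1\le i\le k-1$; its arrival time is $l_k$. A $(u,v)$-journey is foremost if its arrival time is minimum among all $(u,v)$-journeys. Foremost Journey Algorithm (input: $G(L)$, $s$): 1. Sort $S(L)$ in increasing order of labels; let $S'$ be the sorted array. 2. Set $R:=\{s\}$, $arrival\_time[s]:=0$,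 and for all $v\in V\setminus\{s\}$ set $parent[v]:=\emptyset$, $arrival\_time[v]:=+\infty$. 3. For all time edges (arcs) $(a,b,l)$ in the order given by $S'$: if $a\in R$ and $b\notin R$ and $arrival\_time[a]<l$, then set $parent[b]:=a$, $arrival\_time[b]:=l$, $R:=R\cup\{b\}$.
   Formalization: In (c), an edgeless graph on n vertices needs order n steps for initialisation but constant sorting time, so the formal claim is: total time is at most C times the sorting time plus an initialisation time of at most C·n; the latter is absorbed when n ≤ k|S(L)|, with C depending on k. -}

module Defs where

open import Data.Nat using (ℕ; _+_; _≤_; _<_; _<?_)
open import Data.Fin as Fin using (Fin)
open import Data.Fin.Permutation using (Permutation′; _⟨$⟩ʳ_)
open import Data.Fin.Subset using (Subset; inside; outside)
open import Data.Bool using (if_then_else_; _∧_; not)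
open import Data.List using (List; []; _∷_; _++_; map; concatMap; length; lookup; tabulate)
open import Data.List.Membership.Propositional using (_∈_)
open import Data.List.Relation.Unary.All using (All)
open import Data.List.Relation.Unary.Unique.Propositional using (Unique)
open import Data.Maybe using (Maybe; just; nothing)
open import Data.Product using (_×_; _,_; proj₁; proj₂)
open import Data.Vec as Vec using (Vec; replicate; _[_]≔_)
open import Data.Vec.Functional using (Vector)
open import Function using (_∘_)
open import Relation.Binary.Definitions using (Monotonic₁)
open import Relation.Binary.PropositionalEquality using (_≡_)
open import Relation.Nullary using (does)
open import Relation.Nullary.Construct.Add.Supremum using (_⁺; ⊤⁺; [_])
open import Relation.Binary.Construct.Add.Supremum.Strict _<_ using (_<⁺_; <⁺-dec)

record LabelSet : Set where
  field
    labels   : List ℕ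
    distinct : Unique labels
    positive : All (0 <_) labels

open LabelSet public using (labels)

-- In both records the values of L outside the edge (arc) set are never used.

record Digraph (n : ℕ) : Set where
  field
    arcs     : List (Fin n × Fin n)
    distinct : Unique arcs
    L        : Fin n × Fin n → LabelSet

-- The edge {u , v}, u ≠ v, is represented by its increasing pair.
record Graph (n : ℕ) : Set where
  field
    edges    : List (Fin n × Fin n)
    ordered  : All (λ e → proj₁ e Fin.< proj₂ e) edges
    distinct : Unique edges
    L        : Fin n × Fin n → LabelSet

data TemporalGraph (n : ℕ) : Set where
  undirected : Graph n   → TemporalGraph n
  directed   : Digraph n → TemporalGraph n

TimeEdge : ℕ → Set
TimeEdge n = Fin n × Fin n × ℕ

label : ∀ {n} → TimeEdge n → ℕ
label (_ , _ , l) = l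

timeEdges : ∀ {n} → LabelSet → Fin n → Fin n → List (TimeEdge n)
timeEdges Lₑ u v = map (λ l → u , v , l) (labels Lₑ)

S : ∀ {n} → TemporalGraph n → List (TimeEdge n)
S (undirected G) = concatMap
  (λ (u , v) → timeEdges (L (u , v)) u v ++ timeEdges (L (u , v)) v u) edges
  where open Graph G
S (directed G) = concatMap (λ (u , v) → timeEdges (L (u , v)) u v) arcs
  where open Digraph G

-- Journey G u v l is the type of (u , v)-journeys with arrival time l.
data Journey {n} (G : TemporalGraph n) (u : Fin n) : Fin n → ℕ → Set where
  single : ∀ {v l} → (u , v , l) ∈ S G → Journey G u v l
  extend : ∀ {v w l l′} → Journey G u v l → (v , w , l′) ∈ S G → l < l′ →
           Journey G u w l′

Foremost : ∀ {n} {G : TemporalGraph n} {u v l} → Journey G u v l → Set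
Foremost {G = G} {u} {v} {l} _ = ∀ {l′} → Journey G u v l′ → l ≤ l′

-- A value together with the number of unit-cost operations spent on it.
record Timed (A : Set) : Set where
  constructor _after_
  field
    value : A
    time  : ℕ

open Timed public

pure : ∀ {A} → A → Timed A
pure x = x after 0

infixl 1 _>>=_
_>>=_ : ∀ {A B} → Timed A → (A → Timed B) → Timed B
(x after t) >>= f = value (f x) after (t + time (f x))

op : ∀ {A} → A → Timed A
op x = x after 1

fill : ∀ {A} n → A → Timed (Vec A n)
fill n x = replicate n x after n

read : ∀ {A n} → Vec A n → Fin n → Timed A
read a i = op (Vec.lookup a i)

write : ∀ {A n} → Vec A n → Fin n → A → Timed (Vec A n)
write a i x = op (a [ i ]≔ x)

-- One operation per iteration for fetching the next entry.
forEach : ∀ {A B : Set} → List A → B → (A → B → Timed B) → Timed B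
forEach []       b f = pure b
forEach (x ∷ xs) b f = do
  x′ ← op x
  b′ ← f x′ b
  forEach xs b′ f

-- A program that rearranges an array of m keys.  The keys are accessible only
-- through queries, each of unit cost; any other work is accounted for by `step`.
data Program (m : ℕ) : Set where
  return : Permutation′ m → Program m
  step   : Program m → Program m
  query  : Fin m → (ℕ → Program m) → Program m

run : ∀ {m} → Program m → Vector ℕ m → Timed (Permutation′ m)
run (return π)  keys = op π
run (step p)    keys = op p >>= λ _ → run p keys
run (query i p) keys = op (keys i) >>= λ k → run (p k) keys

record SortingAlgorithm : Set where
  field
    program : ∀ m → Program m
    sorts   : ∀ m (keys : Vector ℕ m) →
              Monotonic₁ Fin._≤_ _≤_
                (λ i → keys (value (run (program m) keys) ⟨$⟩ʳ i))

sortByLabel : ∀ {n} → SortingAlgorithm → List (TimeEdge n) → Timed (List (TimeEdge n))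
sortByLabel 𝒜 es = do
  π ← run (program (length es)) (label ∘ lookup es)
  pure (tabulate (λ i → lookup es (π ⟨$⟩ʳ i)))
  where open SortingAlgorithm 𝒜

record State (n : ℕ) : Set where
  constructor state
  field
    R            : Subset n
    parent       : Vec (Maybe (Fin n)) n
    arrival-time : Vec (ℕ ⁺) n

initialise : ∀ {n} → Fin n → Timed (State n)
initialise {n} s = do
  R       ← fill n outside
  R       ← write R s inside
  parent  ← fill n nothing
  arrival ← fill n ⊤⁺
  arrival ← write arrival s [ 0 ]
  pure (state R parent arrival)

process : ∀ {n} → TimeEdge n → State n → Timed (State n)
process (a , b , l) st@(state R parent arrival) = do
  a∈R ← read R a
  b∈R ← read R b
  t   ← read arrival a
  t<l ← op (does (<⁺-dec _<?_ t [ l ]))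
  if a∈R ∧ not b∈R ∧ t<l
    then (do
      parent  ← write parent b (just a)
      arrival ← write arrival b [ l ]
      R       ← write R b inside
      pure (state R parent arrival))
    else pure st

foremostJourneys : ∀ {n} → SortingAlgorithm → TemporalGraph n → Fin n → Timed (State n)
foremostJourneys 𝒜 G s = do
  S′ ← sortByLabel 𝒜 (S G)
  st ← initialise s
  forEach S′ st process

parent : ∀ {n} → State n → Fin n → Maybe (Fin n)
parent st = Vec.lookup (State.parent st)

arrival-time : ∀ {n} → State n → Fin n → ℕ ⁺
arrival-time st = Vec.lookup (State.arrival-time st)

-- Read backwards from its endpoint, the journey consists of the time edges
-- (parent w , w , arrival-time w), until the source is reached.
FollowsParents : ∀ {n} {G : TemporalGraph n} {u v l} → State n → Journey G u v l → Set
FollowsParents {u = u} {v} {l} st (single _) =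
  parent st v ≡ just u × arrival-time st v ≡ [ l ]
FollowsParents {v = w} {l′} st (extend {v = v} J _ _) =
  parent st w ≡ just v × arrival-time st w ≡ [ l′ ] × FollowsParents st J

{-# OPTIONS --safe #-}

-- Correctness: since the time edges are scanned by increasing label, the
-- arrival time of a newly reached vertex is at least every label scanned
-- before.  Hence no time edge scanned earlier can leave that vertex after its
-- arrival, and every scanned time edge stays "settled": if it can be taken, its
-- head has been reached no later than its label.  Foremostness follows by
-- induction on journeys.
--
-- Complexity: the loop costs O(|S|), so |S| has to be bounded by the sorting
-- time on the given labels.  A correct sorting program on at least two positive
-- keys queries each of them: an unqueried key could be 0 or exceed another key,
-- without any effect on the output.

module Submission where

open import Defs
open import Data.Bool using (true; false)
open import Data.Fin as Fin using (Fin; zero; punchIn)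
open import Data.Fin.Permutation using (_⟨$⟩ʳ_; _⟨$⟩ˡ_; inverseʳ)
open import Data.Fin.Properties as Finₚ using (punchInᵢ≢i; injective⇒≤)
open import Data.Fin.Subset using (inside; outside)
open import Data.List using (List; []; _∷_; length; lookup)
import Data.List.Membership.DecPropositional as DecMembership
open import Data.List.Membership.Propositional using (_∈_)
open import Data.List.Membership.Propositional.Properties
  using (∈-lookup; ∈-tabulate⁺; ∈-tabulate⁻)
open import Data.List.Membership.Setoid.Properties using (index-injective)
open import Data.List.Properties using (length-tabulate)
open import Data.List.Relation.Unary.All as All using (All; []; _∷_)
open import Data.List.Relation.Unary.All.Properties
  using (concat⁺; map⁺; ++⁺)
open import Data.List.Relation.Unary.AllPairs using (AllPairs; _∷_)
open import Data.List.Relation.Unary.AllPairs.Properties using (tabulate⁺-<)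
open import Data.List.Relation.Unary.Any using (here; there; index)
open import Data.List.Relation.Unary.Any.Properties using (lookup-index)
open import Data.Maybe using (is-just; just)
open import Data.Maybe.Properties using (just-injective)
open import Data.Nat
  using (ℕ; zero; suc; _+_; _*_; _≤_; _<_; _<?_; z≤n; s≤s)
open import Data.Nat.Properties
open import Data.Nat.Solver using (module +-*-Solver)
open import Data.Product using (Σ; ∃; _×_; _,_; proj₁; proj₂)
open import Data.Sum using (_⊎_; inj₁; inj₂)
open import Data.Vec as Vec using (_[_]≔_)
open import Data.Vec.Functional using (Vector; updateAt)
open import Data.Vec.Functional.Properties using (updateAt-updates; updateAt-minimal)
open import Data.Vec.Properties using (lookup∘update; lookup∘update′; lookup-replicate)
open import Function using (_∘_; const)
open import Relation.Binary.PropositionalEquality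
  using (_≡_; _≢_; refl; sym; trans; cong; subst; setoid)
open import Relation.Nullary using (¬_; yes; no; contradiction)
open import Relation.Nullary.Decidable using (decidable-stable)
open import Relation.Nullary.Construct.Add.Supremum using (⊤⁺; [_])
open import Relation.Binary.Construct.Add.Supremum.Strict _<_
  using (_<⁺_; <⁺-dec; [_]; [_]<⊤⁺)

-- Lower bound for sorting positive keys

queries : ∀ {m} → Program m → Vector ℕ m → List (Fin m)
queries (return π)  keys = []
queries (step p)    keys = queries p keys
queries (query i p) keys = i ∷ queries (p (keys i)) keys

length-queries≤time : ∀ {m} (p : Program m) keys →
  length (queries p keys) ≤ time (run p keys)
length-queries≤time (return π)  keys = z≤n
length-queries≤time (step p)    keys = m≤n⇒m≤1+n (length-queries≤time p keys)
length-queries≤time (query i p) keys = s≤s (length-queries≤time (p (keys i)) keys)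

time-run>0 : ∀ {m} (p : Program m) keys → 0 < time (run p keys)
time-run>0 (return π)  keys = s≤s z≤n
time-run>0 (step p)    keys = s≤s z≤n
time-run>0 (query i p) keys = s≤s z≤n

-- Keys enter a run only through its queries, so equal answers along the path taken on `keys` force
-- the same path on `keys′`.
run-cong : ∀ {m} (p : Program m) {keys keys′} →
  (∀ {i} → i ∈ queries p keys → keys i ≡ keys′ i) →
  value (run p keys) ≡ value (run p keys′)
run-cong (return π)  agree = refl
run-cong (step p)    agree = run-cong p agree
run-cong (query i p) {keys} {keys′} agree =
  trans (run-cong (p (keys i)) (agree ∘ there))
        (cong (λ k → value (run (p k) keys′)) (agree (here refl)))

-- Sending each `i` to a position where it occurs in `is` is injective.
all-queried⇒≤length : ∀ {m} {is : List (Fin m)} → (∀ i → i ∈ is) → m ≤ length is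
all-queried⇒≤length {m} ∈is =
  injective⇒≤ {f = index ∘ ∈is} (index-injective (setoid (Fin m)) (∈is _) (∈is _))

module _ (𝒜 : SortingAlgorithm) where
  open SortingAlgorithm 𝒜

  -- Overwriting key `i` by `x` goes unnoticed by the run, so the same `π` must also sort the
  -- modified keys, among which key `j` is intact.
  unqueried-key-moves-freely : ∀ {m} (keys : Vector ℕ m) {i j} → i ≢ j →
    ¬ i ∈ queries (program m) keys → ∀ x →
    let π = value (run (program m) keys) in
    (π ⟨$⟩ˡ i Fin.≤ π ⟨$⟩ˡ j → x ≤ keys j) × (π ⟨$⟩ˡ j Fin.≤ π ⟨$⟩ˡ i → keys j ≤ x)
  unqueried-key-moves-freely {m} keys {i} {j} i≢j i∉ x = below , above
    where
    π     = value (run (program m) keys)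
    keys′ = updateAt keys i (const x)

    same : π ≡ value (run (program m) keys′)
    same = run-cong (program m) λ {k} k∈ →
      sym (updateAt-minimal k i keys λ { refl → i∉ k∈ })

    sorted : ∀ {p q} → p Fin.≤ q → keys′ (π ⟨$⟩ʳ p) ≤ keys′ (π ⟨$⟩ʳ q)
    sorted = subst (λ ρ → ∀ {p q} → p Fin.≤ q → keys′ (ρ ⟨$⟩ʳ p) ≤ keys′ (ρ ⟨$⟩ʳ q))
                   (sym same) (sorts m keys′)

    at-i : keys′ (π ⟨$⟩ʳ (π ⟨$⟩ˡ i)) ≡ x
    at-i = trans (cong keys′ (inverseʳ π)) (updateAt-updates i keys)

    at-j : keys′ (π ⟨$⟩ʳ (π ⟨$⟩ˡ j)) ≡ keys j
    at-j = trans (cong keys′ (inverseʳ π)) (updateAt-minimal j i keys (i≢j ∘ sym))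

    below : π ⟨$⟩ˡ i Fin.≤ π ⟨$⟩ˡ j → x ≤ keys j
    below le = ≤-trans (≤-reflexive (sym at-i)) (≤-trans (sorted le) (≤-reflexive at-j))

    above : π ⟨$⟩ˡ j Fin.≤ π ⟨$⟩ˡ i → keys j ≤ x
    above le = ≤-trans (≤-reflexive (sym at-j)) (≤-trans (sorted le) (≤-reflexive at-i))

  unqueried-key-is-only-key : ∀ {m} (keys : Vector ℕ m) {i j} → i ≢ j → 0 < keys j →
    ¬ ¬ i ∈ queries (program m) keys
  unqueried-key-is-only-key {m} keys {i} {j} i≢j 0<kⱼ i∉
    with Finₚ.≤-total (π ⟨$⟩ˡ i) (π ⟨$⟩ˡ j)
    where π = value (run (program m) keys)
  -- Key `i` is replaced by a value on the wrong side of key `j`: larger if `π` puts it first, and 0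
  -- otherwise, which is smaller because `keys j` is positive.
  ... | inj₁ i≤j = 1+n≰n (proj₁ (unqueried-key-moves-freely keys i≢j i∉ (suc (keys j))) i≤j)
  ... | inj₂ j≤i = <⇒≱ 0<kⱼ (proj₂ (unqueried-key-moves-freely keys i≢j i∉ 0) j≤i)

  positive-keys-queried : ∀ {m} (keys : Vector ℕ (suc (suc m))) → (∀ i → 0 < keys i) →
    ∀ i → i ∈ queries (program (suc (suc m))) keys
  positive-keys-queried keys pos i = decidable-stable (i ∈? _)
    -- With at least two keys, `punchIn i zero` is an index other than `i` to compare with.
    (unqueried-key-is-only-key keys (punchInᵢ≢i i zero ∘ sym) (pos _))
    where open DecMembership Finₚ._≟_ using (_∈?_)

  -- From two keys on, every key costs a query. A single key may go unqueried, but its run still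
  -- pays one operation for `return`.
  size≤sorting-time : ∀ m (keys : Vector ℕ m) → (∀ i → 0 < keys i) →
    m ≤ time (run (program m) keys)
  size≤sorting-time zero          keys pos = z≤n
  size≤sorting-time (suc zero)    keys pos = time-run>0 (program 1) keys
  size≤sorting-time (suc (suc m)) keys pos =
    ≤-trans (all-queried⇒≤length (positive-keys-queried keys pos))
            (length-queries≤time (program (suc (suc m))) keys)

  -- The sorted array of time edges

  sorted-by-label : ∀ {n} (es : List (TimeEdge n)) →
    AllPairs (λ e e′ → label e ≤ label e′) (value (sortByLabel 𝒜 es))
  sorted-by-label es = tabulate⁺-< (λ i<j → sorts (length es) (label ∘ lookup es) (<⇒≤ i<j))

  ∈-sortByLabel⁺ : ∀ {n} {es : List (TimeEdge n)} {e} →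
    e ∈ es → e ∈ value (sortByLabel 𝒜 es)
  ∈-sortByLabel⁺ {es = es} {e} e∈ =
    subst (_∈ value (sortByLabel 𝒜 es))
      (trans (cong (lookup es) (inverseʳ π)) (sym (lookup-index e∈)))
      (∈-tabulate⁺ (π ⟨$⟩ˡ index e∈))
    where π = value (run (program (length es)) (label ∘ lookup es))

  ∈-sortByLabel⁻ : ∀ {n} {es : List (TimeEdge n)} {e} →
    e ∈ value (sortByLabel 𝒜 es) → e ∈ es
  ∈-sortByLabel⁻ {es = es} e∈ with i , refl ← ∈-tabulate⁻ e∈ = ∈-lookup _

  length-sortByLabel : ∀ {n} (es : List (TimeEdge n)) →
    length (value (sortByLabel 𝒜 es)) ≡ length es
  length-sortByLabel es = length-tabulate _

timeEdges-positive : ∀ {n} (Lₑ : LabelSet) (u v : Fin n) →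
  All (λ e → 0 < label e) (timeEdges Lₑ u v)
timeEdges-positive Lₑ u v = map⁺ (LabelSet.positive Lₑ)

S-positive : ∀ {n} (G : TemporalGraph n) → All (λ e → 0 < label e) (S G)
S-positive (undirected G) = concat⁺ (map⁺ (All.universal
  (λ (u , v) → ++⁺ (timeEdges-positive (L (u , v)) u v) (timeEdges-positive (L (u , v)) v u))
  edges))
  where open Graph G
S-positive (directed G) = concat⁺ (map⁺ (All.universal
  (λ (u , v) → timeEdges-positive (L (u , v)) u v) arcs))
  where open Digraph G

-- Cost and invariants of loops

module _ {A B : Set} {f : A → B → Timed B} where

  forEach-time : ∀ {c} → (∀ x b → time (f x b) ≤ c) →
    ∀ xs b → time (forEach xs b f) ≤ length xs * suc c
  forEach-time f≤c []       b = z≤n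
  forEach-time f≤c (x ∷ xs) b = s≤s (+-mono-≤ (f≤c x b) (forEach-time f≤c xs _))

  -- The invariant also depends on the entries still to come, so that it can compare the state with
  -- the labels not yet scanned.
  forEach-invariant : (I : List A → B → Set) →
    (∀ {x xs b} → I (x ∷ xs) b → I xs (value (f x b))) →
    ∀ xs {b} → I xs b → I [] (value (forEach xs b f))
  forEach-invariant I preserve []       i = i
  forEach-invariant I preserve (x ∷ xs) i = forEach-invariant I preserve xs (preserve i)

-- A single iteration

relax : ∀ {n} → TimeEdge n → State n → State n
relax (a , b , l) (state R parent arrival) =
  state (R [ b ]≔ inside) (parent [ b ]≔ just a) (arrival [ b ]≔ [ l ])

-- Indexing by the timed result lets one case analysis serve both cost and correctness. The 4
-- operations are three reads and a comparison; relaxing adds three writes.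
data ProcessView {n} (e : TimeEdge n) (st : State n) : Timed (State n) → Set where
  relaxed : let a , b , l = e in
    Vec.lookup (State.R st) b ≡ outside → arrival-time st a <⁺ [ l ] →
    ProcessView e st (relax e st after 7)
  skipped : let a , b , l = e in
    (Vec.lookup (State.R st) a ≡ inside → arrival-time st a <⁺ [ l ] →
     Vec.lookup (State.R st) b ≡ inside) →
    ProcessView e st (st after 4)

process-view : ∀ {n} (e : TimeEdge n) (st : State n) → ProcessView e st (process e st)
process-view (a , b , l) st
  with Vec.lookup (State.R st) a in eqa | Vec.lookup (State.R st) b in eqb
     | <⁺-dec _<?_ (arrival-time st a) [ l ]
... | false | _     | _       = skipped λ a∈ _ → contradiction (trans (sym eqa) a∈) λ ()
... | true  | true  | _       = skipped λ _ _ → eqb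
... | true  | false | yes t<l = relaxed eqb t<l
... | true  | false | no  t≮l = skipped λ _ t<l → contradiction t<l t≮l

process-time : ∀ {n} (e : TimeEdge n) (st : State n) → time (process e st) ≤ 7
process-time e st = view-time (process-view e st)
  where
  view-time : ∀ {r} → ProcessView e st r → time r ≤ 7
  view-time (relaxed _ _) = ≤-refl
  view-time (skipped _)   = m≤m+n 4 3

module _ {n} (a : Fin n) {b : Fin n} {l : ℕ} (st : State n) where

  arrival-relax-≡ : arrival-time (relax (a , b , l) st) b ≡ [ l ]
  arrival-relax-≡ = lookup∘update b (State.arrival-time st) _

  arrival-relax-≢ : ∀ {v} → v ≢ b →
    arrival-time (relax (a , b , l) st) v ≡ arrival-time st v
  arrival-relax-≢ v≢b = lookup∘update′ v≢b (State.arrival-time st) _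

  arrival-relax⁻ : ∀ {v t} → arrival-time (relax (a , b , l) st) v ≡ [ t ] →
    (v ≡ b × t ≡ l) ⊎ (v ≢ b × arrival-time st v ≡ [ t ])
  arrival-relax⁻ {v} eq with v Finₚ.≟ b
  ... | yes refl = inj₁ (refl , just-injective (trans (sym eq) arrival-relax-≡))
  ... | no  v≢b  = inj₂ (v≢b , trans (sym (arrival-relax-≢ v≢b)) eq)

-- Persistence of arrival times and parents

infix 4 _⊑_
-- Entries of vertices with a finite arrival time are frozen; the others may change.
_⊑_ : ∀ {n} → State n → State n → Set
st ⊑ st′ = ∀ {v t} → arrival-time st v ≡ [ t ] →
  arrival-time st′ v ≡ [ t ] × parent st′ v ≡ parent st v

⊑-relax : ∀ {n} {st : State n} {a b l} → arrival-time st b ≡ ⊤⁺ →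
  st ⊑ relax (a , b , l) st
⊑-relax {st = st} {a} b≡⊤ eq =
  trans (arrival-relax-≢ a st v≢b) eq , lookup∘update′ v≢b (State.parent st) _
  where v≢b = λ { refl → contradiction (trans (sym b≡⊤) eq) λ () }

-- Every pointer followed belongs to a vertex with a finite arrival time, hence is frozen.
FollowsParents-⊑ : ∀ {n} {G : TemporalGraph n} {u v l} {st st′ : State n} → st ⊑ st′ →
  (J : Journey G u v l) → FollowsParents st J → FollowsParents st′ J
FollowsParents-⊑ st⊑st′ (single _) (p , t) =
  trans (proj₂ (st⊑st′ t)) p , proj₁ (st⊑st′ t)
FollowsParents-⊑ st⊑st′ (extend J _ _) (p , t , fp) =
  trans (proj₂ (st⊑st′ t)) p , proj₁ (st⊑st′ t) , FollowsParents-⊑ st⊑st′ J fp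

<⁺-[]⁻ : ∀ {x l} → x <⁺ [ l ] → ∃ λ t → x ≡ [ t ] × t < l
<⁺-[]⁻ [ t<l ] = _ , refl , t<l

<⁺-⊤⁺⁻ : ∀ {x} → x <⁺ ⊤⁺ → ∃ λ t → x ≡ [ t ]
<⁺-⊤⁺⁻ [ t ]<⊤⁺ = t , refl

-- The loop invariant

Settled : ∀ {n} → State n → TimeEdge n → Set
Settled st (a , b , l) = ∀ {t} → arrival-time st a ≡ [ t ] → t < l →
  ∃ λ t′ → arrival-time st b ≡ [ t′ ] × t′ ≤ l

module _ {n} (G : TemporalGraph n) (s : Fin n) where

  TracedBack : State n → Fin n → ℕ → Set
  TracedBack st v t = Σ (Journey G s v t) (FollowsParents st)

  -- `traced` leaves out `s`, whose time 0 is set by initialisation and not by a journey. In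
  -- `scanned`, the label bound accompanies `Settled` because it is what preserves it when a new
  -- vertex is reached.
  record Invariant (todo : List (TimeEdge n)) (st : State n) : Set where
    field
      sorted  : AllPairs (λ e e′ → label e ≤ label e′) todo
      todo⊆S  : All (_∈ S G) todo
      reached : ∀ v → Vec.lookup (State.R st) v ≡ is-just (arrival-time st v)
      source  : arrival-time st s ≡ [ 0 ]
      traced  : ∀ {v t} → v ≢ s → arrival-time st v ≡ [ t ] → TracedBack st v t
      bounded : ∀ {v t} → arrival-time st v ≡ [ t ] → All (λ e → t ≤ label e) todo
      scanned : ∀ {e} → e ∈ S G →
        e ∈ todo ⊎ (All (λ e′ → label e ≤ label e′) todo × Settled st e)

    unreached : ∀ {v} → Vec.lookup (State.R st) v ≡ outside → arrival-time st v ≡ ⊤⁺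
    unreached {v} v∉R with arrival-time st v | reached v
    ... | ⊤⁺    | _   = refl
    ... | [ _ ] | v∈R = contradiction (trans (sym v∉R) v∈R) λ ()

    has-arrival : ∀ {v} → Vec.lookup (State.R st) v ≡ inside →
      ∃ λ t → arrival-time st v ≡ [ t ]
    has-arrival {v} v∈R with arrival-time st v | reached v
    ... | [ t ] | _   = t , refl
    ... | ⊤⁺    | v∉R = contradiction (trans (sym v∈R) v∉R) λ ()

  skip-invariant : ∀ {a b l todo st} →
    (Vec.lookup (State.R st) a ≡ inside → arrival-time st a <⁺ [ l ] →
     Vec.lookup (State.R st) b ≡ inside) →
    Invariant ((a , b , l) ∷ todo) st → Invariant todo st
  skip-invariant {a} {b} {l} {todo} {st} b∈R inv with Invariant.sorted inv
  ... | l≤todo ∷ todo-sorted = record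
    { sorted  = todo-sorted
    ; todo⊆S  = All.tail todo⊆S
    ; reached = reached
    ; source  = source
    ; traced  = traced
    ; bounded = All.tail ∘ bounded
    ; scanned = scanned′
    }
    where
    open Invariant inv

    scanned′ : ∀ {e} → e ∈ S G →
      e ∈ todo ⊎ (All (λ e′ → label e ≤ label e′) todo × Settled st e)
    scanned′ e∈S with scanned e∈S
    ... | inj₁ (there e∈)   = inj₁ e∈
    ... | inj₂ (le , settl) = inj₂ (All.tail le , settl)
    -- The skipped time edge could be taken only if `b` was already reached; `bounded`, applied
    -- while this edge was still pending, puts that arrival no later than `l`.
    ... | inj₁ (here refl)  = inj₂ (l≤todo , λ a≡t t<l →
      let t′ , b≡t′ = has-arrival (b∈R (trans (reached a) (cong is-just a≡t))
                                       (subst (_<⁺ [ l ]) (sym a≡t) [ t<l ]))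
      in t′ , b≡t′ , All.head (bounded b≡t′))

  relax-invariant : ∀ {a b l todo st} →
    Vec.lookup (State.R st) b ≡ outside → arrival-time st a <⁺ [ l ] →
    Invariant ((a , b , l) ∷ todo) st → Invariant todo (relax (a , b , l) st)
  relax-invariant {a} {b} {l} {todo} {st} b∉R a<l inv with Invariant.sorted inv
  ... | l≤todo ∷ todo-sorted = record
    { sorted  = todo-sorted
    ; todo⊆S  = All.tail todo⊆S
    ; reached = reached′
    ; source  = proj₁ (st⊑st′ source)
    ; traced  = traced′
    ; bounded = bounded′
    ; scanned = scanned′
    }
    where
    open Invariant inv
    st′ = relax (a , b , l) st

    st⊑st′ : st ⊑ st′
    st⊑st′ = ⊑-relax {st = st} (unreached b∉R)

    reached′ : ∀ v → Vec.lookup (State.R st′) v ≡ is-just (arrival-time st′ v)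
    reached′ v with v Finₚ.≟ b
    ... | yes refl = trans (lookup∘update b (State.R st) inside)
                           (cong is-just (sym (arrival-relax-≡ a st)))
    ... | no  v≢b  = trans (lookup∘update′ v≢b (State.R st) inside)
                           (trans (reached v) (cong is-just (sym (arrival-relax-≢ a st v≢b))))

    journey-to-b : TracedBack st′ b l
    journey-to-b with a Finₚ.≟ s | <⁺-[]⁻ a<l
    -- At the source the pointer chain ends, so the time edge alone is the journey.
    ... | yes refl | _ =
      single (All.head todo⊆S) ,
      lookup∘update b (State.parent st) _ , arrival-relax-≡ a st
    ... | no a≢s | t , a≡t , t<l with traced a≢s a≡t
    ...   | J , J-follows =
      extend J (All.head todo⊆S) t<l ,
      lookup∘update b (State.parent st) _ , arrival-relax-≡ a st ,
      FollowsParents-⊑ {st = st} st⊑st′ J J-follows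

    traced′ : ∀ {v t} → v ≢ s → arrival-time st′ v ≡ [ t ] → TracedBack st′ v t
    traced′ v≢s eq with arrival-relax⁻ a st eq
    ... | inj₁ (refl , refl) = journey-to-b
    ... | inj₂ (_ , v≡t) with traced v≢s v≡t
    ...   | J , J-follows = J , FollowsParents-⊑ {st = st} st⊑st′ J J-follows

    bounded′ : ∀ {v t} → arrival-time st′ v ≡ [ t ] → All (λ e → t ≤ label e) todo
    bounded′ eq with arrival-relax⁻ a st eq
    ... | inj₁ (refl , refl) = l≤todo
    ... | inj₂ (_ , v≡t)     = All.tail (bounded v≡t)

    scanned′ : ∀ {e} → e ∈ S G →
      e ∈ todo ⊎ (All (λ e′ → label e ≤ label e′) todo × Settled st′ e)
    scanned′ e∈S with scanned e∈S
    ... | inj₁ (there e∈)   = inj₁ e∈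
    ... | inj₁ (here refl)  = inj₂ (l≤todo , λ _ _ → l , arrival-relax-≡ a st , ≤-refl)
    ... | inj₂ (le , settl) = inj₂ (All.tail le , settled′)
      where
      settled′ : Settled st′ _
      settled′ eq t<l′ with arrival-relax⁻ a st eq
      -- The tail of this earlier time edge is the vertex just reached, at time `l`; its label is at
      -- most `l`, so it cannot be taken after that arrival.
      ... | inj₁ (refl , refl) = contradiction (All.head le) (<⇒≱ t<l′)
      ... | inj₂ (_ , a′≡t) with settl a′≡t t<l′
      ...   | t′ , b′≡t′ , t′≤l′ = t′ , proj₁ (st⊑st′ b′≡t′) , t′≤l′

  process-invariant : ∀ {e todo st} →
    Invariant (e ∷ todo) st → Invariant todo (value (process e st))
  process-invariant {e} {todo} {st} inv = view-invariant (process-view e st)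
    where
    view-invariant : ∀ {r} → ProcessView e st r → Invariant todo (value r)
    view-invariant (relaxed b∉R a<l) = relax-invariant b∉R a<l inv
    view-invariant (skipped b∈R)     = skip-invariant b∈R inv

  -- Initial state and correctness at termination

  initial-arrival : arrival-time (value (initialise s)) s ≡ [ 0 ]
  initial-arrival = lookup∘update s (Vec.replicate n ⊤⁺) [ 0 ]

  initial-arrival-≢ : ∀ {v} → v ≢ s → arrival-time (value (initialise s)) v ≡ ⊤⁺
  initial-arrival-≢ {v} v≢s =
    trans (lookup∘update′ v≢s (Vec.replicate n ⊤⁺) [ 0 ]) (lookup-replicate v ⊤⁺)

  initial-arrival⁻ : ∀ {v t} → arrival-time (value (initialise s)) v ≡ [ t ] → v ≡ s × t ≡ 0
  initial-arrival⁻ {v} eq with v Finₚ.≟ s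
  ... | yes refl = refl , just-injective (trans (sym eq) initial-arrival)
  ... | no  v≢s  = contradiction (trans (sym (initial-arrival-≢ v≢s)) eq) λ ()

  module _ (𝒜 : SortingAlgorithm) where

    private final = value (foremostJourneys 𝒜 G s)

    initial-invariant : Invariant (value (sortByLabel 𝒜 (S G))) (value (initialise s))
    initial-invariant = record
      { sorted  = sorted-by-label 𝒜 (S G)
      ; todo⊆S  = All.tabulate (∈-sortByLabel⁻ 𝒜)
      ; reached = reached
      ; source  = initial-arrival
      ; traced  = λ v≢s eq → contradiction (proj₁ (initial-arrival⁻ eq)) v≢s
      ; bounded = bounded
      ; scanned = inj₁ ∘ ∈-sortByLabel⁺ 𝒜
      }
      where
      st₀ = value (initialise s)

      reached : ∀ v → Vec.lookup (State.R st₀) v ≡ is-just (arrival-time st₀ v)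
      reached v with v Finₚ.≟ s
      ... | yes refl = trans (lookup∘update s (Vec.replicate n outside) inside)
                             (cong is-just (sym initial-arrival))
      ... | no  v≢s  = trans (trans (lookup∘update′ v≢s (Vec.replicate n outside) inside)
                                    (lookup-replicate v outside))
                             (cong is-just (sym (initial-arrival-≢ v≢s)))

      bounded : ∀ {v t} → arrival-time st₀ v ≡ [ t ] →
        All (λ e → t ≤ label e) (value (sortByLabel 𝒜 (S G)))
      bounded eq with initial-arrival⁻ eq
      ... | _ , refl = All.tabulate λ _ → z≤n

    final-invariant : Invariant [] final
    final-invariant = forEach-invariant Invariant process-invariant
      (value (sortByLabel 𝒜 (S G))) initial-invariant

    open Invariant final-invariant

    -- Nothing is pending at termination, so only the second alternative of `scanned` remains.
    final-settled : ∀ {e} → e ∈ S G → Settled final e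
    final-settled e∈S with scanned e∈S
    ... | inj₂ (_ , settl) = settl

    -- Induction along the journey, each of whose time edges is settled. The first can be taken
    -- because labels are positive and `s` has time 0; each later one because the recorded time at
    -- its tail is at most the preceding label.
    arrives-by : ∀ {v l} → Journey G s v l → ∃ λ t → arrival-time final v ≡ [ t ] × t ≤ l
    arrives-by (single e∈S) = final-settled e∈S source (All.lookup (S-positive G) e∈S)
    arrives-by (extend J e∈S l<l′) with arrives-by J
    ... | t , v≡t , t≤l = final-settled e∈S v≡t (≤-<-trans t≤l l<l′)

    foremost-journey : ∀ {v} → v ≢ s → arrival-time final v <⁺ ⊤⁺ →
      ∃ λ t → arrival-time final v ≡ [ t ] ×
      Σ (Journey G s v t) λ J → Foremost J × FollowsParents final J
    foremost-journey {v} v≢s v<⊤ with <⁺-⊤⁺⁻ v<⊤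
    ... | t , v≡t with traced v≢s v≡t
    ...   | J , J-follows = t , v≡t , J , foremost , J-follows
      where
      foremost : Foremost J
      -- The time found for the competitor `J′` is the recorded one, which is also the arrival time
      -- of `J`.
      foremost J′ with arrives-by J′
      ... | t′ , v≡t′ , t′≤l′ =
        subst (_≤ _) (just-injective (trans (sym v≡t′) v≡t)) t′≤l′

    no-journey : ∀ {v} → arrival-time final v ≡ ⊤⁺ → ∀ t → ¬ Journey G s v t
    no-journey v≡⊤ t J with arrives-by J
    ... | _ , v≡t , _ = contradiction (trans (sym v≡⊤) v≡t) λ ()

    -- Running time

    ∣S∣≤sorting-time : length (S G) ≤ time (sortByLabel 𝒜 (S G))
    ∣S∣≤sorting-time = ≤-trans
      (size≤sorting-time 𝒜 _ _ λ i → All.lookup (S-positive G) (∈-lookup i))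
      (m≤m+n _ 0)

    -- Each iteration costs at most 7 plus 1 for the fetch, so the loop costs at most 8 times the
    -- sorting time; sorting itself makes it 9. Initialisation stays separate, since isolated
    -- vertices can make `n` arbitrarily large compared with the number of time edges.
    total-time : time (foremostJourneys 𝒜 G s) ≤
      9 * time (sortByLabel 𝒜 (S G)) + time (initialise s)
    total-time = begin
      σ + (ι + time (forEach S′ _ process))  ≤⟨ +-monoʳ-≤ σ (+-monoʳ-≤ ι (forEach-time process-time S′ _)) ⟩
      σ + (ι + length S′ * 8)                ≡⟨ cong (λ m → σ + (ι + m * 8)) (length-sortByLabel 𝒜 (S G)) ⟩
      σ + (ι + length (S G) * 8)             ≤⟨ +-monoʳ-≤ σ (+-monoʳ-≤ ι (*-monoˡ-≤ 8 ∣S∣≤sorting-time)) ⟩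
      σ + (ι + σ * 8)                        ≡⟨ solve 2 (λ σ ι → σ :+ (ι :+ σ :* con 8) := con 9 :* σ :+ ι) refl σ ι ⟩
      9 * σ + ι                              ∎
      where
      open ≤-Reasoning
      open +-*-Solver
      S′ = value (sortByLabel 𝒜 (S G))
      σ  = time (sortByLabel 𝒜 (S G))
      ι  = time (initialise s)

initialise-time : ∀ {n} (s : Fin n) → time (initialise s) ≤ 5 * n
initialise-time {suc n} s = begin
  N + (1 + (N + (N + (1 + 0))))  ≡⟨ solve 1 (λ N → N :+ (con 1 :+ (N :+ (N :+ con 1))) := con 3 :* N :+ con 2) refl N ⟩
  -- The two single writes are absorbed because the existence of `s` gives `N` at least 1.
  3 * N + 2 * 1                  ≤⟨ +-monoʳ-≤ (3 * N) (*-monoʳ-≤ 2 (s≤s z≤n)) ⟩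
  3 * N + 2 * N                  ≡⟨ sym (*-distribʳ-+ N 3 2) ⟩
  5 * N                          ∎
  where
  open ≤-Reasoning
  open +-*-Solver
  N = suc n

-- Here sorting also pays for initialisation: `n` is at most `k` times the number of time edges,
-- which the sorting time bounds.
total-time-few-vertices : ∀ k {n} (G : TemporalGraph n) (s : Fin n) (𝒜 : SortingAlgorithm) →
  n ≤ k * length (S G) →
  time (foremostJourneys 𝒜 G s) ≤ (9 + 5 * k) * time (sortByLabel 𝒜 (S G))
total-time-few-vertices k {n} G s 𝒜 n≤k∣S∣ = begin
  time (foremostJourneys 𝒜 G s)  ≤⟨ total-time G s 𝒜 ⟩
  9 * σ + time (initialise s)    ≤⟨ +-monoʳ-≤ (9 * σ) (initialise-time s) ⟩
  9 * σ + 5 * n                  ≤⟨ +-monoʳ-≤ (9 * σ) (*-monoʳ-≤ 5 n≤k∣S∣) ⟩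
  9 * σ + 5 * (k * length (S G)) ≤⟨ +-monoʳ-≤ (9 * σ) (*-monoʳ-≤ 5 (*-monoʳ-≤ k (∣S∣≤sorting-time G s 𝒜))) ⟩
  9 * σ + 5 * (k * σ)            ≡⟨ cong (9 * σ +_) (sym (*-assoc 5 k σ)) ⟩
  9 * σ + 5 * k * σ              ≡⟨ sym (*-distribʳ-+ σ 9 (5 * k)) ⟩
  (9 + 5 * k) * σ                ∎
  where
  open ≤-Reasoning
  σ = time (sortByLabel 𝒜 (S G))

theorem1 : (∀ {n} (G : TemporalGraph n) (s : Fin n) (𝒜 : SortingAlgorithm) →
    let final = value (foremostJourneys 𝒜 G s) in
    ∀ v → v ≢ s →
    (arrival-time final v <⁺ ⊤⁺ →
    ∃ λ t → arrival-time final v ≡ [ t ] ×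
    Σ (Journey G s v t) λ J → Foremost J × FollowsParents final J)
    × (arrival-time final v ≡ ⊤⁺ → ∀ t → ¬ Journey G s v t))
    × (∃ λ C → ∀ {n} (G : TemporalGraph n) (s : Fin n) (𝒜 : SortingAlgorithm) →
    time (foremostJourneys 𝒜 G s) ≤ C * time (sortByLabel 𝒜 (S G)) + time (initialise s)
    × time (initialise s) ≤ C * n)
    × (∀ k → ∃ λ C → ∀ {n} (G : TemporalGraph n) (s : Fin n) (𝒜 : SortingAlgorithm) →
    n ≤ k * length (S G) →
    time (foremostJourneys 𝒜 G s) ≤ C * time (sortByLabel 𝒜 (S G)))
theorem1 =
  (λ G s 𝒜 v v≢s → foremost-journey G s 𝒜 v≢s , no-journey G s 𝒜) ,
  -- One constant has to serve both bounds; initialisation alone would need 5.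
  (9 , λ {n} G s 𝒜 →
    total-time G s 𝒜 ,
    ≤-trans (initialise-time s) (*-monoˡ-≤ n (m≤m+n 5 4))) ,
  (λ k → 9 + 5 * k , total-time-few-vertices k)
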